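{- Let $k\ge 6$ and $g=2d\ge 6$, and let $G$ be a $(k,g)$-graph of excess $4$. Let $A$ be the adjacency matrix of $G$, $E$ the excess matrix of $G$, $I$ the identity matrix and $J$ the all-ones matrix (all of size $n\times n$, where $n$ is the order of $G$). Then $$kJ=(A+kI)\bigl(H_{d-1}(A)+E\bigr).$$
   Context: Graphs are finite and simple. A $(k,g)$-graph is a $k$-regular graph of girth $g$. For even $g=2d$ the Moore bound is $M(k,g)=2\bigl(1+(k-1)+\dots+(k-1)^{d-1}\bigr)$, and the excess of a $(k,g)$-graph of order $n$ is $n-M(k,g)$. For $k\ge 6$ and $g=2d\ge 6$, a $(k,g)$-graph $G$ of excess $4$ is bipartite of diameter $d+1$ (known theorem of Biggs and Ito). The excess matrix $E$ of $G$ is the $n\times n$ matrix indexed by the vertices of $G$ with $E_{u,v}=1$ if the distance $d(u,v)$ in $G$ equals $d+1$, and $E_{u,v}=0$ otherwise. The polynomials $H_i(x)$ (Dickson polynomials of the second kind with parameter $k-1$) are defined by $H_0(x)=1$, $H_1(x)=x$, and $H_{i+1}(x)=xH_i(x)-(k-1)H_{i-1}(x)$ for $i\ge 1$. -}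

module Defs where

open import Data.Bool.Base using (if_then_else_)
open import Data.Fin.Base using (Fin; toℕ)
import Data.Fin.Properties as Fin
open import Data.Fin.Subset using (Subset; ∣_∣)
open import Data.Integer.Base as ℤ using (ℤ; +_; 0ℤ; 1ℤ)
import Data.Integer.Properties as ℤ
open import Data.List.Base as List using (List; []; _∷_)
open import Data.Nat.Base as ℕ using (ℕ; zero; suc; _∸_; _≤_; _<_)
import Data.Nat.ListAction as ℕ
import Data.Nat.Properties as ℕ
open import Data.Product.Base using (∃; _×_; _,_)
open import Data.Vec.Base using (tabulate)
open import Function.Definitions using (Injective)
open import Level using (0ℓ)
open import Relation.Binary.Core using (Rel)
open import Relation.Binary.Definitions using (Decidable; Irreflexive; Symmetric)
open import Relation.Binary.PropositionalEquality.Core using (_≡_; refl)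
open import Relation.Nullary.Decidable using (Dec; does; ¬?; map′; _×-dec_)
open import Relation.Nullary.Negation.Core using (¬_)

open import Algebra.Properties.Semiring.Sum ℤ.+-*-semiring using (sum)

record Graph (n : ℕ) : Set₁ where
  infix 4 _∼_ _∼?_
  field
    _∼_     : Rel (Fin n) 0ℓ
    _∼?_    : Decidable _∼_
    ∼-sym   : Symmetric _∼_
    ∼-irrefl : Irreflexive _≡_ _∼_

module _ {n : ℕ} (G : Graph n) where
  open Graph G

  neighbours : Fin n → Subset n
  neighbours u = tabulate λ v → does (u ∼? v)

  degree : Fin n → ℕ
  degree u = ∣ neighbours u ∣

  Regular : ℕ → Set
  Regular k = ∀ u → degree u ≡ k

  record Cycle (m : ℕ) : Set where
    field
      length≥3  : 3 ≤ m
      vertex    : Fin m → Fin n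
      injective : Injective _≡_ _≡_ vertex
      step      : ∀ i j → suc (toℕ i) ≡ toℕ j → vertex i ∼ vertex j
      close     : ∀ i j → suc (toℕ i) ≡ m → toℕ j ≡ 0 → vertex i ∼ vertex j

  HasGirth : ℕ → Set
  HasGirth g = Cycle g × (∀ {m} → Cycle m → g ≤ m)

  data Walk : ℕ → Rel (Fin n) 0ℓ where
    []  : ∀ {u} → Walk 0 u u
    _∷_ : ∀ {m u v w} → u ∼ v → Walk m v w → Walk (suc m) u w

  walk? : ∀ m → Decidable (Walk m)
  walk? zero    u w = map′ (λ { refl → [] }) (λ { [] → refl }) (u Fin.≟ w)
  walk? (suc m) u w =
    map′ (λ { (_ , e , p) → e ∷ p }) (λ { (e ∷ p) → _ , e , p })
         (Fin.any? λ v → (u ∼? v) ×-dec walk? m v w)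

  -- The distance is kept as a relation, since it is undefined (infinite)
  -- between different components.
  Distance : Fin n → Fin n → ℕ → Set
  Distance u v m = Walk m u v × (∀ {l} → l < m → ¬ Walk l u v)

  distance? : ∀ u v m → Dec (Distance u v m)
  distance? u v m =
    walk? m u v ×-dec ℕ.allUpTo? (λ l → ¬? (walk? l u v)) m

record IsKGGraph {n : ℕ} (k g : ℕ) (G : Graph n) : Set where
  field
    regular : Regular G k
    girth   : HasGirth G g

-- Here and in excess and excessMatrix, the girth is 2d.
mooreBound : (k d : ℕ) → ℕ
mooreBound k d = 2 ℕ.* ℕ.sum (List.applyUpTo (λ i → (k ∸ 1) ℕ.^ i) d)

excess : ∀ {n} → Graph n → (k d : ℕ) → ℤ
excess {n} G k d = + n ℤ.- + mooreBound k d

Matrix : ℕ → Set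
Matrix n = Fin n → Fin n → ℤ

infix  4 _≈ᴹ_
infixl 6 _+ᴹ_
infixl 7 _*ᴹ_
infixr 8 _·ᴹ_

_≈ᴹ_ : ∀ {n} → Rel (Matrix n) 0ℓ
M ≈ᴹ N = ∀ u v → M u v ≡ N u v

_+ᴹ_ : ∀ {n} → Matrix n → Matrix n → Matrix n
(M +ᴹ N) u v = M u v ℤ.+ N u v

_*ᴹ_ : ∀ {n} → Matrix n → Matrix n → Matrix n
(M *ᴹ N) u v = sum λ w → M u w ℤ.* N w v

_·ᴹ_ : ∀ {n} → ℤ → Matrix n → Matrix n
(c ·ᴹ M) u v = c ℤ.* M u v

zeroᴹ : ∀ {n} → Matrix n
zeroᴹ u v = 0ℤ

identity : ∀ {n} → Matrix n
identity u v = if does (u Fin.≟ v) then 1ℤ else 0ℤ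

allOnes : ∀ {n} → Matrix n
allOnes u v = 1ℤ

adjacency : ∀ {n} → Graph n → Matrix n
adjacency G u v = if does (Graph._∼?_ G u v) then 1ℤ else 0ℤ

excessMatrix : ∀ {n} → Graph n → (d : ℕ) → Matrix n
excessMatrix G d u v = if does (distance? G u v (suc d)) then 1ℤ else 0ℤ

-- Coefficients, constant term first; trailing zeros are allowed.
Poly : Set
Poly = List ℤ

infixl 6 _+ᴾ_
infixr 8 _·ᴾ_

_+ᴾ_ : Poly → Poly → Poly
[]      +ᴾ q       = q
(a ∷ p) +ᴾ []      = a ∷ p
(a ∷ p) +ᴾ (b ∷ q) = (a ℤ.+ b) ∷ (p +ᴾ q)

_·ᴾ_ : ℤ → Poly → Poly
c ·ᴾ p = List.map (c ℤ.*_) p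

x*_ : Poly → Poly
x* p = 0ℤ ∷ p

evalᴹ : ∀ {n} → Poly → Matrix n → Matrix n
evalᴹ []      M = zeroᴹ
evalᴹ (a ∷ p) M = a ·ᴹ identity +ᴹ M *ᴹ evalᴹ p M

-- Dickson polynomials of the second kind with parameter k − 1.
H : (k : ℕ) → ℕ → Poly
H k zero          = 1ℤ ∷ []
H k (suc zero)    = 0ℤ ∷ 1ℤ ∷ []
H k (suc (suc i)) = (x* H k (suc i)) +ᴾ (ℤ.- (+ k ℤ.- 1ℤ)) ·ᴾ H k i

-- Write h = H_{d-1}(A). Below half the girth, H_i(A) is the 0/1 indicator of a
-- walk of length i. For an edge uv the rows of h at u and v are therefore
-- disjoint, and comparing row sums with the Moore bound leaves a set X of
-- exactly four vertices that neither row covers. Let x ∈ X have p neighbours in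
-- row u, q in row v and r in X. As A commutes with h, a neighbour of x in row u
-- has at least q neighbours in X, and one in row v at least p; there being
-- neither triangles nor 4-cycles, counting the vertices of X within two steps
-- of x gives 2pq + 2r ≤ k + 3. Since p + q + r = k ≥ 6, exactly one of p, q
-- vanishes, so x is at distance d from one end of uv and d + 1 from the other.
-- Hence rows u and v of h + E add up to the all-ones row for every edge uv, and
-- summing over the k edges at u gives the identity.

module Submission where

open import Defs
open import Data.Bool.Base using (true; false; if_then_else_)
open import Data.Fin.Base using (Fin; toℕ) renaming (zero to fzero; suc to fsuc)
import Data.Fin.Properties as Fin
open import Data.Fin.Subset using (∣_∣)
open import Data.Integer.Base as ℤ using (ℤ; +_; 0ℤ; 1ℤ)
import Data.Integer.Properties as ℤ
import Data.Integer.Tactic.RingSolver as ℤ-Solver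
open import Data.List.Base using ([]; _∷_; applyUpTo)
open import Data.Nat.Base as ℕ using (ℕ; zero; suc; _+_; _*_; _∸_; _^_; _≤_; _<_; _≥_; z≤n; s≤s; z<s)
import Data.Nat.Induction as ℕ
import Data.Nat.ListAction as ℕ
import Data.Nat.Properties as ℕ
open import Data.Product.Base using (∃; _×_; _,_; proj₁; proj₂)
open import Data.Sum.Base using (_⊎_; inj₁; inj₂)
import Data.Vec.Base as Vec
open import Function.Base using (_∘_; _$_; case_of_)
open import Relation.Binary.Definitions using (tri<; tri≈; tri>)
open import Relation.Binary.PropositionalEquality
open import Relation.Nullary.Decidable using (Dec; yes; no; does; dec-true; dec-false)
open import Relation.Nullary.Negation using (¬_; contradiction)

open import Algebra.Properties.Semiring.Sum ℤ.+-*-semiring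
  using (sum; sum-cong-≗; sum-replicate-zero; ∑-distrib-+; ∑-comm; *-distribˡ-sum)

open ≡-Reasoning

-- Indicators, integer inequalities and finite sums.

⟦_⟧ : ∀ {P : Set} → Dec P → ℤ
⟦ p? ⟧ = if does p? then 1ℤ else 0ℤ

⟦⟧-true : ∀ {P : Set} (p? : Dec P) → P → ⟦ p? ⟧ ≡ 1ℤ
⟦⟧-true p? p = cong (if_then 1ℤ else 0ℤ) (dec-true p? p)

⟦⟧-false : ∀ {P : Set} (p? : Dec P) → ¬ P → ⟦ p? ⟧ ≡ 0ℤ
⟦⟧-false p? ¬p = cong (if_then 1ℤ else 0ℤ) (dec-false p? ¬p)

⟦⟧-nonNeg : ∀ {P : Set} (p? : Dec P) → 0ℤ ℤ.≤ ⟦ p? ⟧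
⟦⟧-nonNeg (yes _) = ℤ.+≤+ z≤n
⟦⟧-nonNeg (no  _) = ℤ.+≤+ z≤n

-- Linear inequalities are derived by certificates: y − x = b − a is left to
-- the ring solver.
≤-transfer : ∀ {a b x y} → a ℤ.≤ b → a ℤ.+ y ≡ b ℤ.+ x → x ℤ.≤ y
≤-transfer {a} {b} {x} {y} a≤b eq =
  ℤ.0≤i-j⇒j≤i $ subst (0ℤ ℤ.≤_) difference (ℤ.i≤j⇒0≤j-i a≤b)
  where
  rearrange : ∀ a b x y → y ℤ.- x ≡ (a ℤ.+ y) ℤ.- (a ℤ.+ x)
  rearrange = ℤ-Solver.solve-∀
  rearrange′ : ∀ a b x → (b ℤ.+ x) ℤ.- (a ℤ.+ x) ≡ b ℤ.- a
  rearrange′ = ℤ-Solver.solve-∀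
  difference : b ℤ.- a ≡ y ℤ.- x
  difference = sym $ begin
    y ℤ.- x                       ≡⟨ rearrange a b x y ⟩
    (a ℤ.+ y) ℤ.- (a ℤ.+ x)       ≡⟨ cong (ℤ._- (a ℤ.+ x)) eq ⟩
    (b ℤ.+ x) ℤ.- (a ℤ.+ x)       ≡⟨ rearrange′ a b x ⟩
    b ℤ.- a                       ∎

sum-mono : ∀ {n} {f g : Fin n → ℤ} → (∀ i → f i ℤ.≤ g i) → sum f ℤ.≤ sum g
sum-mono {zero}  f≤g = ℤ.≤-refl
sum-mono {suc n} f≤g = ℤ.+-mono-≤ (f≤g fzero) (sum-mono (f≤g ∘ fsuc))

sum-const : ∀ n c → sum {n} (λ _ → c) ≡ + n ℤ.* c
sum-const zero    c = sym (ℤ.*-zeroˡ c)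
sum-const (suc n) c = begin
  c ℤ.+ sum {n} (λ _ → c)  ≡⟨ cong (λ s → c ℤ.+ s) (sum-const n c) ⟩
  c ℤ.+ + n ℤ.* c          ≡⟨ sym (ℤ.suc-* (+ n) c) ⟩
  ℤ.suc (+ n) ℤ.* c        ∎

sum-identityˡ : ∀ {n} (u : Fin n) (f : Fin n → ℤ) → sum (λ w → identity u w ℤ.* f w) ≡ f u
sum-identityˡ {suc n} fzero f = begin
  1ℤ ℤ.* f fzero ℤ.+ sum (λ w → 0ℤ ℤ.* f (fsuc w))
    ≡⟨ cong₂ ℤ._+_ (ℤ.*-identityˡ (f fzero)) (sum-cong-≗ (λ w → ℤ.*-zeroˡ (f (fsuc w)))) ⟩
  f fzero ℤ.+ sum {n} (λ _ → 0ℤ)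
    ≡⟨ cong (λ s → f fzero ℤ.+ s) (sum-replicate-zero n) ⟩
  f fzero ℤ.+ 0ℤ
    ≡⟨ ℤ.+-identityʳ (f fzero) ⟩
  f fzero ∎
sum-identityˡ {suc n} (fsuc u) f = begin
  0ℤ ℤ.* f fzero ℤ.+ sum (λ w → identity u w ℤ.* f (fsuc w))
    ≡⟨ cong₂ ℤ._+_ (ℤ.*-zeroˡ (f fzero)) (sum-identityˡ u (f ∘ fsuc)) ⟩
  0ℤ ℤ.+ f (fsuc u)
    ≡⟨ ℤ.+-identityˡ (f (fsuc u)) ⟩
  f (fsuc u) ∎

identity-sym : ∀ {n} (u v : Fin n) → identity u v ≡ identity v u
identity-sym u v with u Fin.≟ v
... | yes u≡v = sym (⟦⟧-true (v Fin.≟ u) (sym u≡v))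
... | no  u≢v = sym (⟦⟧-false (v Fin.≟ u) (u≢v ∘ sym))

sum-identityʳ : ∀ {n} (v : Fin n) (f : Fin n → ℤ) → sum (λ w → f w ℤ.* identity w v) ≡ f v
sum-identityʳ v f = begin
  sum (λ w → f w ℤ.* identity w v)
    ≡⟨ sum-cong-≗ (λ w → trans (ℤ.*-comm (f w) (identity w v)) (cong (ℤ._* f w) (identity-sym w v))) ⟩
  sum (λ w → identity v w ℤ.* f w)
    ≡⟨ sum-identityˡ v f ⟩
  f v ∎

-- Turns a degree, defined as the cardinality of a subset, into a row sum of the adjacency matrix.
sum-does : ∀ {n} {P : Fin n → Set} (P? : ∀ i → Dec (P i)) →
           sum (λ i → ⟦ P? i ⟧) ≡ + ∣ Vec.tabulate (λ i → does (P? i)) ∣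
sum-does {zero}  P? = refl
sum-does {suc n} P? with does (P? fzero)
... | true  = cong ℤ.suc (sum-does (P? ∘ fsuc))
... | false = trans (ℤ.+-identityˡ _) (sum-does (P? ∘ fsuc))

-- For `c = k ∸ 1` and `m = d` this is half of the Moore bound, in the form to which `mooreBound`
-- unfolds.
geometricSum : ℕ → ℕ → ℕ
geometricSum c m = ℕ.sum (applyUpTo (c ^_) m)

sum-applyUpTo-* : ∀ c f m → ℕ.sum (applyUpTo (λ i → c * f i) m) ≡ c * ℕ.sum (applyUpTo f m)
sum-applyUpTo-* c f zero    = sym (ℕ.*-zeroʳ c)
sum-applyUpTo-* c f (suc m) =
  trans (cong (λ s → c * f 0 + s) (sum-applyUpTo-* c (f ∘ suc) m)) (sym (ℕ.*-distribˡ-+ c (f 0) _))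

geometricSum-suc : ∀ c m → geometricSum c (suc m) ≡ 1 + c * geometricSum c m
geometricSum-suc c m = cong suc (sum-applyUpTo-* c (c ^_) m)

-- Walks

module _ {n : ℕ} (G : Graph n) where
  open Graph G

  snoc : ∀ {m u v w} → Walk G m u v → v ∼ w → Walk G (suc m) u w
  snoc []      e = e ∷ []
  snoc (a ∷ p) e = a ∷ snoc p e

  reverse : ∀ {m u v} → Walk G m u v → Walk G m v u
  reverse []      = []
  reverse (e ∷ p) = snoc (reverse p) (∼-sym e)

  infixr 5 _++_
  _++_ : ∀ {l m u v w} → Walk G l u v → Walk G m v w → Walk G (l + m) u w
  []      ++ q = q
  (e ∷ p) ++ q = e ∷ (p ++ q)

  -- Walks as total sequences: only the values up to index `m` matter, so cutting and shifting are
  -- compositions with functions on `ℕ`.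
  IsWalk : (ℕ → Fin n) → ℕ → Set
  IsWalk f m = ∀ i → i < m → f i ∼ f (suc i)

  -- Only interior indices are constrained, so a closed sequence may backtrack at its base point.
  NonBacktracking : (ℕ → Fin n) → ℕ → Set
  NonBacktracking f m = ∀ i → suc (suc i) ≤ m → f i ≢ f (suc (suc i))

  cons : Fin n → (ℕ → Fin n) → ℕ → Fin n
  cons x f zero    = x
  cons x f (suc i) = f i

  isWalk-cons : ∀ {x f m} → x ∼ f 0 → IsWalk f m → IsWalk (cons x f) (suc m)
  isWalk-cons e w zero    _         = e
  isWalk-cons e w (suc i) (s≤s i<m) = w i i<m

  record NBPath (m : ℕ) (u v : Fin n) : Set where
    field
      vertex          : ℕ → Fin n
      isWalk          : IsWalk vertex m
      nonBacktracking : NonBacktracking vertex m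
      start           : vertex 0 ≡ u
      end             : vertex m ≡ v
  open NBPath

  toWalk : ∀ m f → IsWalk f m → Walk G m (f 0) (f m)
  toWalk zero    f w = []
  toWalk (suc m) f w = w 0 z<s ∷ toWalk m (f ∘ suc) (λ i i<m → w (suc i) (s≤s i<m))

  -- If the new edge is retraced at once, dropping both steps leaves a walk of length `m`. Otherwise
  -- the longer path remembers its first step, which `first-step-unique` compares.
  extend : ∀ {m u v w} → u ∼ w → NBPath (suc m) w v →
           Walk G m u v ⊎ ∃ λ (p : NBPath (2 + m) u v) → vertex p 1 ≡ w
  extend {m} {u} {v} e p with u Fin.≟ vertex p 1
  ... | yes refl = inj₁ $ subst (Walk G m u) (end p) $
    toWalk m (vertex p ∘ suc) (λ i i<m → isWalk p (suc i) (s≤s i<m))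
  ... | no u≢p₁ = inj₂ $ record
    { vertex          = cons u (vertex p)
    ; isWalk          = isWalk-cons (subst (u ∼_) (sym (start p)) e) (isWalk p)
    ; nonBacktracking = λ { zero _ → u≢p₁ ; (suc i) (s≤s i≤) → nonBacktracking p i i≤ }
    ; start           = refl
    ; end             = end p
    } , start p

  -- Cancelling a single backtrack suffices. It costs exactly two steps, so the parity of the length
  -- survives.
  reduce : ∀ {m u v} → Walk G m u v → NBPath m u v ⊎ ∃ λ i → m ≡ 2 + i × Walk G i u v
  reduce {u = u} [] = inj₁ record
    { vertex = λ _ → u ; isWalk = λ _ () ; nonBacktracking = λ _ () ; start = refl ; end = refl }
  reduce {u = u} {v} (e ∷ []) = inj₁ record
    { vertex          = cons u (λ _ → v)
    ; isWalk          = λ { zero _ → e ; (suc _) (s≤s ()) }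
    ; nonBacktracking = λ { _ (s≤s ()) }
    ; start           = refl
    ; end             = refl
    }
  reduce (e ∷ p@(_ ∷ _)) with reduce p
  ... | inj₂ (i , refl , q) = inj₂ (suc i , refl , e ∷ q)
  ... | inj₁ p′ with extend e p′
  ...   | inj₁ q        = inj₂ (_ , refl , q)
  ...   | inj₂ (p″ , _) = inj₁ p″

  -- The first `t` steps of `p`, reversed, are put in front of `q`. The inequality carried along is
  -- the induction invariant: the result does not begin by stepping to the next vertex of `p`, so
  -- that vertex can be prepended without backtracking.
  glue : ∀ {a b u v w} (p : NBPath a u v) (q : NBPath b u w) → vertex p 1 ≢ vertex q 1 →
         ∀ t → t ≤ a → ∃ λ (r : NBPath (t + b) (vertex p t) w) → t < a → vertex r 1 ≢ vertex p (suc t)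
  glue p q p₁≢q₁ zero    _   = record
    { vertex          = vertex q
    ; isWalk          = isWalk q
    ; nonBacktracking = nonBacktracking q
    ; start           = trans (start q) (sym (start p))
    ; end             = end q
    } , λ _ → p₁≢q₁ ∘ sym
  glue p q p₁≢q₁ (suc t) t<a with glue p q p₁≢q₁ t (ℕ.<⇒≤ t<a)
  ... | r , r₁≢ = record
    { vertex          = cons (vertex p (suc t)) (vertex r)
    ; isWalk          = isWalk-cons
        (subst (vertex p (suc t) ∼_) (sym (start r)) (∼-sym (isWalk p t t<a))) (isWalk r)
    ; nonBacktracking = λ { zero _ → r₁≢ t<a ∘ sym ; (suc i) (s≤s i≤) → nonBacktracking r i i≤ }
    ; start           = refl
    ; end             = end r
    } , λ t+1<a eq → nonBacktracking p t t+1<a (trans (sym (start r)) eq)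

  -- A repeated vertex inside a closed walk cuts out a shorter closed walk,
  -- which is still non-backtracking as its end points are not checked.
  closed⇒cycle : ∀ m f → IsWalk f (suc m) → NonBacktracking f (suc m) → f 0 ≡ f (suc m) →
                 ∃ λ l → l ≤ suc m × Cycle G l
  closed⇒cycle = ℕ.<-rec _ shorten
    where
    Goal : ℕ → Set
    Goal m = ∀ f → IsWalk f (suc m) → NonBacktracking f (suc m) → f 0 ≡ f (suc m) →
             ∃ λ l → l ≤ suc m × Cycle G l

    shorten : ∀ m → (∀ {m′} → m′ < m → Goal m′) → Goal m
    shorten m rec f w nb closed
      -- Indices stop at `m`, so the coincidence of `f 0` and `f (suc m)` is not found. Any repeat
      -- then bounds a closed walk of length `j - i = suc l` with `l < m`.
      with ℕ.anyUpTo? (λ j → ℕ.anyUpTo? (λ i → f i Fin.≟ f j) j) (suc m)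
    ... | yes (j , j≤m , i , i<j , fi≡fj) =
      let l = j ∸ suc i
          i+1+l≡j = ℕ.m+[n∸m]≡n i<j
          l<m = ℕ.<-≤-trans (ℕ.∸-monoʳ-< {j} {suc i} {0} z<s i<j) (ℕ.≤-pred j≤m)
          inside : ∀ {t} → t ≤ suc l → i + t ≤ suc m
          inside t≤ = ℕ.≤-trans (ℕ.+-monoʳ-≤ i t≤)
            (ℕ.≤-trans (ℕ.≤-reflexive (trans (ℕ.+-suc i l) i+1+l≡j)) (ℕ.<⇒≤ j≤m))
          (c , c≤ , cyc) = rec l<m (λ t → f (i + t))
            (λ t t< → subst (λ s → f (i + t) ∼ f s) (sym (ℕ.+-suc i t))
                        (w (i + t) (subst (_≤ suc m) (ℕ.+-suc i t) (inside t<))))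
            (λ t t≤ → subst (λ s → f (i + t) ≢ f s)
                        (sym (trans (ℕ.+-suc i (suc t)) (cong suc (ℕ.+-suc i t))))
                        (nb (i + t) (subst (_≤ suc m) (trans (ℕ.+-suc i (suc t)) (cong suc (ℕ.+-suc i t))) (inside t≤))))
            (trans (cong f (ℕ.+-identityʳ i)) (trans fi≡fj (cong f (sym (trans (ℕ.+-suc i l) i+1+l≡j)))))
      in c , ℕ.≤-trans c≤ (ℕ.≤-trans l<m (ℕ.n≤1+n m)) , cyc
    ... | no ¬repeat = suc m , ℕ.≤-refl , record
      { length≥3  = three m w nb closed
      ; vertex    = f ∘ toℕ
      ; injective = λ {i} {j} eq → Fin.toℕ-injective (distinct (Fin.toℕ<n i) (Fin.toℕ<n j) eq)
      ; step      = λ i j eq → subst (λ s → f (toℕ i) ∼ f s) eq (w (toℕ i) (Fin.toℕ<n i))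
      ; close     = λ i j eq eq′ → subst (f (toℕ i) ∼_)
                      (trans (cong f eq) (trans (sym closed) (cong f (sym eq′)))) (w (toℕ i) (Fin.toℕ<n i))
      }
      where
      three : ∀ m → IsWalk f (suc m) → NonBacktracking f (suc m) → f 0 ≡ f (suc m) → 3 ≤ suc m
      three zero          w nb closed = contradiction (w 0 z<s) (∼-irrefl closed)
      three (suc zero)    w nb closed = contradiction closed (nb 0 ℕ.≤-refl)
      three (suc (suc m)) w nb closed = s≤s (s≤s (s≤s z≤n))
      distinct : ∀ {i j} → i < suc m → j < suc m → f i ≡ f j → i ≡ j
      distinct {i} {j} i≤m j≤m eq with ℕ.<-cmp i j
      ... | tri< i<j _ _ = contradiction (j , j≤m , i , i<j , eq) ¬repeat
      ... | tri≈ _ i≡j _ = i≡j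
      ... | tri> _ _ j<i = contradiction (i , i≤m , j , j<i , sym eq) ¬repeat

  -- Consequences of the girth.

  module _ (d : ℕ) (girth≥ : ∀ {l} → Cycle G l → d + d ≤ l) where

    no-closed-NBPath : ∀ {m u} → suc m < d + d → ¬ NBPath (suc m) u u
    no-closed-NBPath {m} short p =
      case closed⇒cycle m (vertex p) (isWalk p) (nonBacktracking p) (trans (start p) (sym (end p))) of
        λ (l , l≤ , c) → ℕ.<⇒≱ short (ℕ.≤-trans (girth≥ c) l≤)

    -- A non-backtracking one would contain a cycle shorter than `d + d`. Otherwise two steps cancel
    -- and an odd closed walk remains; a walk of length 1 has no two steps to lose.
    no-odd-closed-walk : ∀ j {u} → j < d → ¬ Walk G (suc (j + j)) u u
    no-odd-closed-walk j j<d p with reduce p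
    ... | inj₁ p′ = no-closed-NBPath
      (subst (_≤ d + d) (cong suc (ℕ.+-suc j j)) (ℕ.+-mono-≤ j<d j<d)) p′
    no-odd-closed-walk zero    j<d p | inj₂ (i , () , q)
    no-odd-closed-walk (suc j) {u} j<d p | inj₂ (i , eq , q) =
      no-odd-closed-walk j (ℕ.<⇒≤ j<d) (subst (λ i → Walk G i u u) i≡ q)
      where
      i≡ : i ≡ suc (j + j)
      i≡ = sym (trans (sym (ℕ.+-suc j j)) (ℕ.suc-injective (ℕ.suc-injective eq)))

    -- The edge and the two walks would close up to length `2m + 1`.
    walks-from-edge : ∀ {m u v w} → m < d → u ∼ v → Walk G m u w → ¬ Walk G m v w
    walks-from-edge m<d e p q = no-odd-closed-walk _ m<d (e ∷ (q ++ reverse p))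

    -- Without a walk of length `i`, the two walks of length `2 + i` cannot backtrack. With
    -- different first steps they would glue to a closed path of length below the girth.
    first-step-unique : ∀ {i u v w w′} → 2 + i < d → ¬ Walk G i u v →
      u ∼ w → Walk G (suc i) w v → u ∼ w′ → Walk G (suc i) w′ v → w ≡ w′
    first-step-unique {i} {u} {v} i+2<d ¬short e p e′ p′ with path e p | path e′ p′
      where
      path : ∀ {w} → u ∼ w → Walk G (suc i) w v → ∃ λ (r : NBPath (2 + i) u v) → vertex r 1 ≡ w
      path e p with reduce p
      ... | inj₂ (_ , refl , q) = contradiction (e ∷ q) ¬short
      ... | inj₁ r with extend e r
      ...   | inj₁ q = contradiction q ¬short
      ...   | inj₂ r′ = r′
    ... | r , refl | r′ , refl with vertex r 1 Fin.≟ vertex r′ 1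
    ...   | yes eq = eq
    ...   | no neq = contradiction
      -- Taking all of `r` in `glue` makes the path start, as well as end, at `v`.
      (subst (λ x → NBPath (2 + i + (2 + i)) x v) (end r) (proj₁ (glue r r′ neq (2 + i) ℕ.≤-refl)))
      (no-closed-NBPath (ℕ.+-mono-<-≤ i+2<d (ℕ.<⇒≤ i+2<d)))

  -- Going to a neighbour and back adds two steps, so the parity of `m ∸ l` decides which length is
  -- reached.
  pad : (∀ u → ∃ λ v → u ∼ v) → ∀ {l m u v} → l ≤ m → Walk G l u v → Walk G m u v ⊎ Walk G (suc m) u v
  pad neighbour {l} {u = u} {v} l≤m p = go (ℕ.≤⇒≤′ l≤m)
    where
    go : ∀ {m} → l ℕ.≤′ m → Walk G m u v ⊎ Walk G (suc m) u v
    go (ℕ.≤′-reflexive refl) = inj₁ p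
    go (ℕ.≤′-step l≤m) with go l≤m
    ... | inj₂ q = inj₁ q
    ... | inj₁ q = case neighbour u of λ (_ , e) → inj₂ (e ∷ ∼-sym e ∷ q)

-- Polynomials in a matrix

evalᴹ-+ᴾ : ∀ {n} p q (M : Matrix n) → evalᴹ (p +ᴾ q) M ≈ᴹ evalᴹ p M +ᴹ evalᴹ q M
evalᴹ-+ᴾ []      q       M u v = sym (ℤ.+-identityˡ _)
evalᴹ-+ᴾ (a ∷ p) []      M u v = sym (ℤ.+-identityʳ _)
evalᴹ-+ᴾ (a ∷ p) (b ∷ q) M u v = begin
  (a ℤ.+ b) ℤ.* identity u v ℤ.+ (M *ᴹ evalᴹ (p +ᴾ q) M) u v
    ≡⟨ cong (λ s → (a ℤ.+ b) ℤ.* identity u v ℤ.+ s) split ⟩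
  (a ℤ.+ b) ℤ.* identity u v ℤ.+ ((M *ᴹ evalᴹ p M) u v ℤ.+ (M *ᴹ evalᴹ q M) u v)
    ≡⟨ rearrange a b (identity u v) ((M *ᴹ evalᴹ p M) u v) ((M *ᴹ evalᴹ q M) u v) ⟩
  evalᴹ (a ∷ p) M u v ℤ.+ evalᴹ (b ∷ q) M u v ∎
  where
  rearrange : ∀ a b i x y → (a ℤ.+ b) ℤ.* i ℤ.+ (x ℤ.+ y) ≡ (a ℤ.* i ℤ.+ x) ℤ.+ (b ℤ.* i ℤ.+ y)
  rearrange = ℤ-Solver.solve-∀
  split : (M *ᴹ evalᴹ (p +ᴾ q) M) u v ≡ (M *ᴹ evalᴹ p M) u v ℤ.+ (M *ᴹ evalᴹ q M) u v
  split = begin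
    sum (λ w → M u w ℤ.* evalᴹ (p +ᴾ q) M w v)
      ≡⟨ sum-cong-≗ (λ w → trans (cong (λ s → M u w ℤ.* s) (evalᴹ-+ᴾ p q M w v))
                                 (ℤ.*-distribˡ-+ (M u w) (evalᴹ p M w v) (evalᴹ q M w v))) ⟩
    sum (λ w → M u w ℤ.* evalᴹ p M w v ℤ.+ M u w ℤ.* evalᴹ q M w v)
      ≡⟨ ∑-distrib-+ (λ w → M u w ℤ.* evalᴹ p M w v) (λ w → M u w ℤ.* evalᴹ q M w v) ⟩
    (M *ᴹ evalᴹ p M) u v ℤ.+ (M *ᴹ evalᴹ q M) u v ∎

evalᴹ-·ᴾ : ∀ {n} c p (M : Matrix n) → evalᴹ (c ·ᴾ p) M ≈ᴹ c ·ᴹ evalᴹ p M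
evalᴹ-·ᴾ c []      M u v = sym (ℤ.*-zeroʳ c)
evalᴹ-·ᴾ c (a ∷ p) M u v = begin
  c ℤ.* a ℤ.* identity u v ℤ.+ (M *ᴹ evalᴹ (c ·ᴾ p) M) u v
    ≡⟨ cong (λ s → c ℤ.* a ℤ.* identity u v ℤ.+ s) pull ⟩
  c ℤ.* a ℤ.* identity u v ℤ.+ c ℤ.* (M *ᴹ evalᴹ p M) u v
    ≡⟨ factor c a (identity u v) ((M *ᴹ evalᴹ p M) u v) ⟩
  c ℤ.* evalᴹ (a ∷ p) M u v ∎
  where
  factor : ∀ c a i x → c ℤ.* a ℤ.* i ℤ.+ c ℤ.* x ≡ c ℤ.* (a ℤ.* i ℤ.+ x)
  factor = ℤ-Solver.solve-∀
  swap : ∀ m c x → m ℤ.* (c ℤ.* x) ≡ c ℤ.* (m ℤ.* x)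
  swap = ℤ-Solver.solve-∀
  pull : (M *ᴹ evalᴹ (c ·ᴾ p) M) u v ≡ c ℤ.* (M *ᴹ evalᴹ p M) u v
  pull = begin
    sum (λ w → M u w ℤ.* evalᴹ (c ·ᴾ p) M w v)
      ≡⟨ sum-cong-≗ (λ w → trans (cong (λ s → M u w ℤ.* s) (evalᴹ-·ᴾ c p M w v))
                                 (swap (M u w) c (evalᴹ p M w v))) ⟩
    sum (λ w → c ℤ.* (M u w ℤ.* evalᴹ p M w v))
      ≡⟨ sym (*-distribˡ-sum c (λ w → M u w ℤ.* evalᴹ p M w v)) ⟩
    c ℤ.* (M *ᴹ evalᴹ p M) u v ∎

evalᴹ-x* : ∀ {n} p (M : Matrix n) → evalᴹ (x* p) M ≈ᴹ M *ᴹ evalᴹ p M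
evalᴹ-x* p M u v = begin
  0ℤ ℤ.* identity u v ℤ.+ (M *ᴹ evalᴹ p M) u v
    ≡⟨ cong (ℤ._+ (M *ᴹ evalᴹ p M) u v) (ℤ.*-zeroˡ (identity u v)) ⟩
  0ℤ ℤ.+ (M *ᴹ evalᴹ p M) u v
    ≡⟨ ℤ.+-identityˡ _ ⟩
  (M *ᴹ evalᴹ p M) u v ∎

evalᴹ-constant : ∀ {n} a (M : Matrix n) → evalᴹ (a ∷ []) M ≈ᴹ a ·ᴹ identity
evalᴹ-constant {n} a M u v = begin
  a ℤ.* identity u v ℤ.+ sum (λ w → M u w ℤ.* 0ℤ)
    ≡⟨ cong (λ s → a ℤ.* identity u v ℤ.+ s) (sum-cong-≗ (λ w → ℤ.*-zeroʳ (M u w))) ⟩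
  a ℤ.* identity u v ℤ.+ sum {n} (λ _ → 0ℤ)
    ≡⟨ cong (λ s → a ℤ.* identity u v ℤ.+ s) (sum-replicate-zero n) ⟩
  a ℤ.* identity u v ℤ.+ 0ℤ
    ≡⟨ ℤ.+-identityʳ _ ⟩
  a ℤ.* identity u v ∎

-- Neighbourhood sums and the matrices `h i` of a regular graph.

module _ {n : ℕ} (G : Graph n) (k : ℕ) (regular : Regular G k) where
  open Graph G

  private
    A : Matrix n
    A = adjacency G

    h : ℕ → Matrix n
    h i = evalᴹ (H k i) A

    c : ℤ
    c = + k ℤ.- 1ℤ

  A-true : ∀ {u v} → u ∼ v → A u v ≡ 1ℤ
  A-true {u} {v} = ⟦⟧-true (u ∼? v)

  A-false : ∀ {u v} → ¬ u ∼ v → A u v ≡ 0ℤ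
  A-false {u} {v} = ⟦⟧-false (u ∼? v)

  A-sym : ∀ u v → A u v ≡ A v u
  A-sym u v with u ∼? v
  ... | yes e = sym (A-true (∼-sym e))
  ... | no ¬e = sym (A-false (¬e ∘ ∼-sym))

  -- The matrix `A` applied to the vector `f`. Keeping it a weighted sum over all vertices lets sums
  -- be interchanged without tracking neighbourhoods.
  ∑∼ : Fin n → (Fin n → ℤ) → ℤ
  ∑∼ u f = sum λ v → A u v ℤ.* f v

  ∑∼-mono : ∀ u {f g} → (∀ {v} → u ∼ v → f v ℤ.≤ g v) → ∑∼ u f ℤ.≤ ∑∼ u g
  ∑∼-mono u {f} {g} f≤g = sum-mono pointwise
    where
    pointwise : ∀ v → A u v ℤ.* f v ℤ.≤ A u v ℤ.* g v
    pointwise v with u ∼? v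
    ... | yes e = subst₂ ℤ._≤_ (sym (ℤ.*-identityˡ (f v))) (sym (ℤ.*-identityˡ (g v))) (f≤g e)
    ... | no ¬e = ℤ.≤-reflexive (trans (ℤ.*-zeroˡ (f v)) (sym (ℤ.*-zeroˡ (g v))))

  ∑∼-cong : ∀ u {f g} → (∀ {v} → u ∼ v → f v ≡ g v) → ∑∼ u f ≡ ∑∼ u g
  ∑∼-cong u f≡g = ℤ.≤-antisym (∑∼-mono u (ℤ.≤-reflexive ∘ f≡g)) (∑∼-mono u (ℤ.≤-reflexive ∘ sym ∘ f≡g))

  ∑∼-+ : ∀ u f g → ∑∼ u (λ v → f v ℤ.+ g v) ≡ ∑∼ u f ℤ.+ ∑∼ u g
  ∑∼-+ u f g = trans (sum-cong-≗ (λ v → ℤ.*-distribˡ-+ (A u v) (f v) (g v)))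
                     (∑-distrib-+ (λ v → A u v ℤ.* f v) (λ v → A u v ℤ.* g v))

  ∑∼-*ˡ : ∀ u a f → ∑∼ u (λ v → a ℤ.* f v) ≡ a ℤ.* ∑∼ u f
  ∑∼-*ˡ u a f = trans (sum-cong-≗ (λ v → swap (A u v) a (f v)))
                      (sym (*-distribˡ-sum a (λ v → A u v ℤ.* f v)))
    where
    swap : ∀ m c x → m ℤ.* (c ℤ.* x) ≡ c ℤ.* (m ℤ.* x)
    swap = ℤ-Solver.solve-∀

  ∑∼-1 : ∀ u → ∑∼ u (λ _ → 1ℤ) ≡ + k
  ∑∼-1 u = begin
    sum (λ v → A u v ℤ.* 1ℤ)  ≡⟨ sum-cong-≗ (λ v → ℤ.*-identityʳ (A u v)) ⟩
    sum (A u)                 ≡⟨ sum-does (u ∼?_) ⟩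
    + degree G u              ≡⟨ cong +_ (regular u) ⟩
    + k                       ∎

  ∑∼-const : ∀ u a → ∑∼ u (λ _ → a) ≡ a ℤ.* + k
  ∑∼-const u a = begin
    ∑∼ u (λ _ → a)           ≡⟨ ∑∼-cong u (λ _ → sym (ℤ.*-identityʳ a)) ⟩
    ∑∼ u (λ _ → a ℤ.* 1ℤ)    ≡⟨ ∑∼-*ˡ u a (λ _ → 1ℤ) ⟩
    a ℤ.* ∑∼ u (λ _ → 1ℤ)    ≡⟨ cong (λ s → a ℤ.* s) (∑∼-1 u) ⟩
    a ℤ.* + k                ∎

  ∑∼-comm : ∀ u v (M : Matrix n) → ∑∼ u (λ x → ∑∼ v (λ y → M x y)) ≡ ∑∼ v (λ y → ∑∼ u (λ x → M x y))
  ∑∼-comm u v M = begin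
    sum (λ x → A u x ℤ.* ∑∼ v (λ y → M x y))
      ≡⟨ sum-cong-≗ (λ x → sym (∑∼-*ˡ v (A u x) (λ y → M x y))) ⟩
    sum (λ x → sum (λ y → A v y ℤ.* (A u x ℤ.* M x y)))
      ≡⟨ ∑-comm (λ x y → A v y ℤ.* (A u x ℤ.* M x y)) ⟩
    sum (λ y → sum (λ x → A v y ℤ.* (A u x ℤ.* M x y)))
      ≡⟨ sum-cong-≗ (λ y → sym (*-distribˡ-sum (A v y) (λ x → A u x ℤ.* M x y))) ⟩
    sum (λ y → A v y ℤ.* ∑∼ u (λ x → M x y)) ∎

  ∑∼-sum : ∀ {m} u (M : Fin n → Fin m → ℤ) → ∑∼ u (λ x → sum (M x)) ≡ sum (λ y → ∑∼ u (λ x → M x y))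
  ∑∼-sum u M = begin
    sum (λ x → A u x ℤ.* sum (M x))
      ≡⟨ sum-cong-≗ (λ x → *-distribˡ-sum (A u x) (M x)) ⟩
    sum (λ x → sum (λ y → A u x ℤ.* M x y))
      ≡⟨ ∑-comm (λ x y → A u x ℤ.* M x y) ⟩
    sum (λ y → ∑∼ u (λ x → M x y)) ∎

  H₀ : h 0 ≈ᴹ identity
  H₀ u v = trans (evalᴹ-constant 1ℤ A u v) (ℤ.*-identityˡ (identity u v))

  H₁ : h 1 ≈ᴹ A
  H₁ u v = begin
    h 1 u v                                   ≡⟨ evalᴹ-x* (1ℤ ∷ []) A u v ⟩
    sum (λ w → A u w ℤ.* h 0 w v)             ≡⟨ sum-cong-≗ (λ w → cong (λ s → A u w ℤ.* s) (H₀ w v)) ⟩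
    sum (λ w → A u w ℤ.* identity w v)        ≡⟨ sum-identityʳ v (A u) ⟩
    A u v                                     ∎

  H₂₊ : ∀ i u v → h (2 + i) u v ≡ ∑∼ u (λ w → h (1 + i) w v) ℤ.+ ℤ.- c ℤ.* h i u v
  H₂₊ i u v = trans (evalᴹ-+ᴾ (x* H k (suc i)) ((ℤ.- c) ·ᴾ H k i) A u v)
                    (cong₂ ℤ._+_ (evalᴹ-x* (H k (suc i)) A u v) (evalᴹ-·ᴾ (ℤ.- c) (H k i) A u v))

  -- As `A` is symmetric, the two sides are entries of `h i *ᴹ A` and `A *ᴹ h i`. The recurrence
  -- reduces the claim to lower indices once the sums over the two neighbourhoods are interchanged.
  H-commutes : ∀ i u v → ∑∼ v (λ x → h i u x) ≡ ∑∼ u (λ x → h i x v)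
  H-commutes zero u v = begin
    ∑∼ v (h 0 u)              ≡⟨ ∑∼-cong v (λ {x} _ → trans (H₀ u x) (identity-sym u x)) ⟩
    ∑∼ v (λ x → identity x u) ≡⟨ sum-identityʳ u (A v) ⟩
    A v u                     ≡⟨ A-sym v u ⟩
    A u v                     ≡⟨ sum-identityʳ v (A u) ⟨
    ∑∼ u (λ x → identity x v) ≡⟨ ∑∼-cong u (λ {x} _ → sym (H₀ x v)) ⟩
    ∑∼ u (λ x → h 0 x v)      ∎
  H-commutes (suc zero) u v = sum-cong-≗ λ x → begin
    A v x ℤ.* h 1 u x  ≡⟨ cong₂ ℤ._*_ (trans (A-sym v x) (sym (H₁ x v))) (H₁ u x) ⟩
    h 1 x v ℤ.* A u x  ≡⟨ ℤ.*-comm (h 1 x v) (A u x) ⟩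
    A u x ℤ.* h 1 x v  ∎
  H-commutes (suc (suc i)) u v = begin
    ∑∼ v (λ x → h (2 + i) u x)
      ≡⟨ ∑∼-cong v (λ {x} _ → H₂₊ i u x) ⟩
    ∑∼ v (λ x → ∑∼ u (λ w → h (1 + i) w x) ℤ.+ ℤ.- c ℤ.* h i u x)
      ≡⟨ ∑∼-+ v (λ x → ∑∼ u (λ w → h (1 + i) w x)) (λ x → ℤ.- c ℤ.* h i u x) ⟩
    ∑∼ v (λ x → ∑∼ u (λ w → h (1 + i) w x)) ℤ.+ ∑∼ v (λ x → ℤ.- c ℤ.* h i u x)
      ≡⟨ cong₂ ℤ._+_ (∑∼-comm v u (λ x w → h (1 + i) w x)) (∑∼-*ˡ v (ℤ.- c) (h i u)) ⟩
    ∑∼ u (λ w → ∑∼ v (λ x → h (1 + i) w x)) ℤ.+ ℤ.- c ℤ.* ∑∼ v (λ x → h i u x)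
      ≡⟨ cong₂ (λ s t → s ℤ.+ ℤ.- c ℤ.* t) (∑∼-cong u (λ {w} _ → H-commutes (suc i) w v)) (H-commutes i u v) ⟩
    ∑∼ u (λ w → ∑∼ w (λ x → h (1 + i) x v)) ℤ.+ ℤ.- c ℤ.* ∑∼ u (λ x → h i x v)
      ≡⟨ cong (λ s → ∑∼ u (λ w → ∑∼ w (λ x → h (1 + i) x v)) ℤ.+ s) (∑∼-*ˡ u (ℤ.- c) (λ x → h i x v)) ⟨
    ∑∼ u (λ w → ∑∼ w (λ x → h (1 + i) x v)) ℤ.+ ∑∼ u (λ w → ℤ.- c ℤ.* h i w v)
      ≡⟨ ∑∼-+ u (λ w → ∑∼ w (λ x → h (1 + i) x v)) (λ w → ℤ.- c ℤ.* h i w v) ⟨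
    ∑∼ u (λ w → ∑∼ w (λ x → h (1 + i) x v) ℤ.+ ℤ.- c ℤ.* h i w v)
      ≡⟨ ∑∼-cong u (λ {w} _ → sym (H₂₊ i w v)) ⟩
    ∑∼ u (λ w → h (2 + i) w v) ∎

  -- By regularity the row sums satisfy `s (2 + i) = k * s (1 + i) - (k - 1) * s i`, the recurrence
  -- of the geometric sums. At `i = d - 1` the value is half of the Moore bound.
  sum-H : ∀ i u → k ≥ 1 → sum (h i u) ≡ + geometricSum (k ∸ 1) (suc i)
  sum-H zero u _ = begin
    sum (h 0 u)                         ≡⟨ sum-cong-≗ (λ v → trans (H₀ u v) (sym (ℤ.*-identityʳ (identity u v)))) ⟩
    sum (λ v → identity u v ℤ.* 1ℤ)     ≡⟨ sum-identityˡ u (λ _ → 1ℤ) ⟩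
    1ℤ                                  ∎
  sum-H (suc zero) u (s≤s _) = begin
    sum (h 1 u)           ≡⟨ sum-cong-≗ (λ v → trans (H₁ u v) (sym (ℤ.*-identityʳ (A u v)))) ⟩
    ∑∼ u (λ _ → 1ℤ)       ≡⟨ ∑∼-1 u ⟩
    + k                   ≡⟨ cong (λ s → + suc s) (trans (ℕ.+-identityʳ _) (ℕ.*-identityʳ (k ∸ 1))) ⟨
    + geometricSum (k ∸ 1) 2  ∎
  sum-H (suc (suc i)) u k≥1 = begin
    sum (h (2 + i) u)
      ≡⟨ sum-cong-≗ (H₂₊ i u) ⟩
    sum (λ v → ∑∼ u (λ w → h (1 + i) w v) ℤ.+ ℤ.- c ℤ.* h i u v)
      ≡⟨ ∑-distrib-+ (λ v → ∑∼ u (λ w → h (1 + i) w v)) (λ v → ℤ.- c ℤ.* h i u v) ⟩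
    sum (λ v → ∑∼ u (λ w → h (1 + i) w v)) ℤ.+ sum (λ v → ℤ.- c ℤ.* h i u v)
      ≡⟨ cong₂ ℤ._+_ (∑∼-sum u (h (1 + i))) (*-distribˡ-sum (ℤ.- c) (h i u)) ⟨
    ∑∼ u (λ w → sum (h (1 + i) w)) ℤ.+ ℤ.- c ℤ.* sum (h i u)
      ≡⟨ cong₂ (λ s t → s ℤ.+ ℤ.- c ℤ.* t)
           (trans (∑∼-cong u (λ {w} _ → sum-H (suc i) w k≥1)) (∑∼-const u (+ S (2 + i)))) (sum-H i u k≥1) ⟩
    + S (2 + i) ℤ.* + k ℤ.+ ℤ.- c ℤ.* + S (1 + i)
      ≡⟨ recurrence k k≥1 ⟩
    + S (3 + i) ∎
    where
    S : ℕ → ℕ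
    S = geometricSum (k ∸ 1)
    -- Here `b` stands for `k - 1` and `s` for `S (1 + i)`, so that `1 + b * s` is `S (2 + i)`.
    cancel : ∀ b s → (1ℤ ℤ.+ b ℤ.* s) ℤ.* (1ℤ ℤ.+ b) ℤ.+ ℤ.- (1ℤ ℤ.+ b ℤ.- 1ℤ) ℤ.* s
                     ≡ 1ℤ ℤ.+ b ℤ.* (1ℤ ℤ.+ b ℤ.* s)
    cancel = ℤ-Solver.solve-∀
    unfold : ∀ b m → + geometricSum b (suc m) ≡ 1ℤ ℤ.+ + b ℤ.* + geometricSum b m
    unfold b m = begin
      + geometricSum b (suc m)            ≡⟨ cong +_ (geometricSum-suc b m) ⟩
      1ℤ ℤ.+ + (b * geometricSum b m)     ≡⟨ cong (λ s → 1ℤ ℤ.+ s) (ℤ.pos-* b (geometricSum b m)) ⟩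
      1ℤ ℤ.+ + b ℤ.* + geometricSum b m   ∎
    recurrence : ∀ k → k ≥ 1 →
      + geometricSum (k ∸ 1) (2 + i) ℤ.* + k ℤ.+ ℤ.- (+ k ℤ.- 1ℤ) ℤ.* + geometricSum (k ∸ 1) (1 + i)
      ≡ + geometricSum (k ∸ 1) (3 + i)
    recurrence (suc b) _ = begin
      + g (2 + i) ℤ.* + suc b ℤ.+ ℤ.- (+ suc b ℤ.- 1ℤ) ℤ.* + g (1 + i)
        ≡⟨ cong (λ s → s ℤ.* + suc b ℤ.+ ℤ.- (+ suc b ℤ.- 1ℤ) ℤ.* + g (1 + i)) (unfold b (1 + i)) ⟩
      (1ℤ ℤ.+ + b ℤ.* + g (1 + i)) ℤ.* (1ℤ ℤ.+ + b) ℤ.+ ℤ.- (1ℤ ℤ.+ + b ℤ.- 1ℤ) ℤ.* + g (1 + i)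
        ≡⟨ cancel (+ b) (+ g (1 + i)) ⟩
      1ℤ ℤ.+ + b ℤ.* (1ℤ ℤ.+ + b ℤ.* + g (1 + i))
        ≡⟨ cong (λ s → 1ℤ ℤ.+ + b ℤ.* s) (unfold b (1 + i)) ⟨
      1ℤ ℤ.+ + b ℤ.* + g (2 + i)
        ≡⟨ unfold b (2 + i) ⟨
      + g (3 + i) ∎
      where
      g : ℕ → ℕ
      g = geometricSum b

  term≤∑∼ : ∀ {u v f} → (∀ w → 0ℤ ℤ.≤ f w) → u ∼ v → f v ℤ.≤ ∑∼ u f
  term≤∑∼ {u} {v} {f} f≥0 e = subst (ℤ._≤ ∑∼ u f) (sum-identityˡ v f) (sum-mono pointwise)
    where
    pointwise : ∀ w → identity v w ℤ.* f w ℤ.≤ A u w ℤ.* f w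
    pointwise w with v Fin.≟ w
    ... | yes refl = ℤ.≤-reflexive (cong (ℤ._* f v) (sym (A-true e)))
    ... | no _ with u ∼? w
    ...   | yes _ = subst₂ ℤ._≤_ (sym (ℤ.*-zeroˡ (f w))) (sym (ℤ.*-identityˡ (f w))) (f≥0 w)
    ...   | no _  = ℤ.≤-reflexive refl

  ∑∼-zero : ∀ {u f} → (∀ {v} → u ∼ v → f v ≡ 0ℤ) → ∑∼ u f ≡ 0ℤ
  ∑∼-zero {u} f≡0 = trans (∑∼-cong u f≡0) (trans (∑∼-const u 0ℤ) (ℤ.*-zeroˡ (+ k)))

  neighbour : k ≥ 1 → ∀ u → ∃ λ v → u ∼ v
  neighbour k≥1 u with Fin.any? (u ∼?_)
  ... | yes ∃v = ∃v
  ... | no ∄v = contradiction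
    (ℤ.+-injective (trans (sym (∑∼-1 u)) (∑∼-zero (λ {v} e → contradiction (v , e) ∄v))))
    (ℕ.>⇒≢ k≥1)

  -- The matrices `h i` below half the girth.

  module _ (d : ℕ) (girth≥ : ∀ {l} → Cycle G l → d + d ≤ l) (k≥1 : k ≥ 1) where

    -- If a walk of length `i` exists, every neighbour of `u` can step back to `u` and follow it, so
    -- the recurrence gives `k - (k - 1) = 1`. If none exists, the correction vanishes and a walk of
    -- length `2 + i` has only one possible first step, so the sum is 1 or 0.
    H-walk : ∀ i → i < d → ∀ u v → h i u v ≡ ⟦ walk? G i u v ⟧
    H-walk zero       _ u v = H₀ u v
    H-walk (suc zero) _ u v = trans (H₁ u v) (edge (u ∼? v))
      where
      edge : Dec (u ∼ v) → A u v ≡ ⟦ walk? G 1 u v ⟧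
      edge (yes e) = trans (A-true e) (sym (⟦⟧-true (walk? G 1 u v) (e ∷ [])))
      edge (no ¬e) = trans (A-false ¬e) (sym (⟦⟧-false (walk? G 1 u v) λ { (e ∷ []) → ¬e e }))
    H-walk (suc (suc i)) i+2<d u v = begin
      h (2 + i) u v
        ≡⟨ H₂₊ i u v ⟩
      ∑∼ u (λ w → h (1 + i) w v) ℤ.+ ℤ.- c ℤ.* h i u v
        ≡⟨ cong₂ (λ s t → s ℤ.+ ℤ.- c ℤ.* t)
             (∑∼-cong u (λ {w} _ → H-walk (suc i) (ℕ.<⇒≤ i+2<d) w v))
             (H-walk i (ℕ.<⇒≤ (ℕ.<⇒≤ i+2<d)) u v) ⟩
      ∑∼ u (λ w → ⟦ walk? G (1 + i) w v ⟧) ℤ.+ ℤ.- c ℤ.* ⟦ walk? G i u v ⟧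
        ≡⟨ count (walk? G i u v) (walk? G (2 + i) u v) ⟩
      ⟦ walk? G (2 + i) u v ⟧ ∎
      where
      W : Fin n → ℤ
      W w = ⟦ walk? G (1 + i) w v ⟧
      cancel : ∀ k → k ℤ.+ ℤ.- (k ℤ.- 1ℤ) ℤ.* 1ℤ ≡ 1ℤ
      cancel = ℤ-Solver.solve-∀
      no-correction : ∀ c s → s ℤ.+ ℤ.- c ℤ.* 0ℤ ≡ s
      no-correction = ℤ-Solver.solve-∀
      count : (short? : Dec (Walk G i u v)) (long? : Dec (Walk G (2 + i) u v)) →
              ∑∼ u W ℤ.+ ℤ.- c ℤ.* ⟦ short? ⟧ ≡ ⟦ long? ⟧
      count (yes p) (no ¬q) =
        case neighbour k≥1 u of λ (_ , e) → contradiction (e ∷ ∼-sym e ∷ p) ¬q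
      count (yes p) (yes _) = begin
        ∑∼ u W ℤ.+ ℤ.- c ℤ.* 1ℤ
          ≡⟨ cong (ℤ._+ ℤ.- c ℤ.* 1ℤ)
               (trans (∑∼-cong u (λ {w} e → ⟦⟧-true (walk? G (1 + i) w v) (∼-sym e ∷ p))) (∑∼-1 u)) ⟩
        + k ℤ.+ ℤ.- c ℤ.* 1ℤ
          ≡⟨ cancel (+ k) ⟩
        1ℤ ∎
      count (no _) (no ¬q) = begin
        ∑∼ u W ℤ.+ ℤ.- c ℤ.* 0ℤ
          ≡⟨ no-correction c (∑∼ u W) ⟩
        ∑∼ u W
          ≡⟨ ∑∼-zero (λ {w} e → ⟦⟧-false (walk? G (1 + i) w v) (λ p → ¬q (e ∷ p))) ⟩
        0ℤ ∎
      count (no ¬p) (yes (_∷_ {v = w₀} e₀ q)) = begin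
        ∑∼ u W ℤ.+ ℤ.- c ℤ.* 0ℤ
          ≡⟨ no-correction c (∑∼ u W) ⟩
        ∑∼ u W
          ≡⟨ sum-cong-≗ only-w₀ ⟩
        sum (λ w → identity w₀ w ℤ.* 1ℤ)
          ≡⟨ sum-identityˡ w₀ (λ _ → 1ℤ) ⟩
        1ℤ ∎
        where
        only-w₀ : ∀ w → A u w ℤ.* W w ≡ identity w₀ w ℤ.* 1ℤ
        only-w₀ w with w₀ Fin.≟ w
        ... | yes refl = cong₂ ℤ._*_ (A-true e₀) (⟦⟧-true (walk? G (1 + i) w v) q)
        ... | no w₀≢w with u ∼? w
        ...   | no _  = refl
        ...   | yes e = trans (ℤ.*-identityˡ (W w)) $ ⟦⟧-false (walk? G (1 + i) w v)
          (w₀≢w ∘ first-step-unique G d girth≥ i+2<d ¬p e₀ q e)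

  -- The four vertices missed by the two rows of an edge.

  module _ (m : ℕ) (m≥2 : m ≥ 2) (girth≥ : ∀ {l} → Cycle G l → suc m + suc m ≤ l)
           (k≥6 : k ≥ 6) (order : + n ≡ + 4 ℤ.+ + mooreBound k (suc m)) where

    private
      k≥1 : k ≥ 1
      k≥1 = ℕ.≤-trans (s≤s z≤n) k≥6

      h-walk : ∀ u v → h m u v ≡ ⟦ walk? G m u v ⟧
      h-walk = H-walk (suc m) girth≥ k≥1 m ℕ.≤-refl

    h-true : ∀ {u v} → Walk G m u v → h m u v ≡ 1ℤ
    h-true {u} {v} p = trans (h-walk u v) (⟦⟧-true (walk? G m u v) p)

    h-false : ∀ {u v} → ¬ Walk G m u v → h m u v ≡ 0ℤ
    h-false {u} {v} ¬p = trans (h-walk u v) (⟦⟧-false (walk? G m u v) ¬p)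

    h-nonNeg : ∀ u v → 0ℤ ℤ.≤ h m u v
    h-nonNeg u v = subst (0ℤ ℤ.≤_) (sym (h-walk u v)) (⟦⟧-nonNeg (walk? G m u v))

    h-edge≤1 : ∀ {u v} → u ∼ v → ∀ w → h m u w ℤ.+ h m v w ℤ.≤ 1ℤ
    h-edge≤1 {u} {v} e w = subst (ℤ._≤ 1ℤ) (sym (cong₂ ℤ._+_ (h-walk u w) (h-walk v w)))
                                 (bound (walk? G m u w) (walk? G m v w))
      where
      bound : (p? : Dec (Walk G m u w)) (q? : Dec (Walk G m v w)) → ⟦ p? ⟧ ℤ.+ ⟦ q? ⟧ ℤ.≤ 1ℤ
      bound (yes p) (yes q) = contradiction q (walks-from-edge G (suc m) girth≥ ℕ.≤-refl e p)
      bound (yes _) (no _)  = ℤ.≤-refl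
      bound (no _)  (yes _) = ℤ.≤-refl
      bound (no _)  (no _)  = ℤ.+≤+ z≤n

    h-sym : ∀ u v → h m u v ≡ h m v u
    h-sym u v with walk? G m u v
    ... | yes p = trans (h-true p) (sym (h-true (reverse G p)))
    ... | no ¬p = trans (h-false ¬p) (sym (h-false (¬p ∘ reverse G)))

    h-edge≤1′ : ∀ {u v} → u ∼ v → ∀ w → h m w u ℤ.+ h m w v ℤ.≤ 1ℤ
    h-edge≤1′ {u} {v} e w = subst (ℤ._≤ 1ℤ) (cong₂ ℤ._+_ (h-sym u w) (h-sym v w)) (h-edge≤1 e w)

    -- For adjacent u and v, the indicator of X; the half-girth is m + 1.
    ξ : Fin n → Fin n → Fin n → ℤ
    ξ u v x = 1ℤ ℤ.- (h m u x ℤ.+ h m v x)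

    ξ-swap : ∀ u v x → ξ u v x ≡ ξ v u x
    ξ-swap u v x = cong (λ s → 1ℤ ℤ.- s) (ℤ.+-comm (h m u x) (h m v x))

    ξ-nonNeg : ∀ {u v} → u ∼ v → ∀ x → 0ℤ ℤ.≤ ξ u v x
    ξ-nonNeg e x = ℤ.i≤j⇒0≤j-i (h-edge≤1 e x)

    -- Each row sum is half of the Moore bound, and the order exceeds the whole bound by 4.
    sum-ξ : ∀ u v → sum (ξ u v) ≡ + 4
    sum-ξ u v = begin
      sum (ξ u v)
        ≡⟨ add-sub (sum (ξ u v)) (sum (h m u)) (sum (h m v)) ⟩
      sum (ξ u v) ℤ.+ (sum (h m u) ℤ.+ sum (h m v)) ℤ.- (sum (h m u) ℤ.+ sum (h m v))
        ≡⟨ cong₂ ℤ._-_ total (cong₂ ℤ._+_ (sum-H m u k≥1) (sum-H m v k≥1)) ⟩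
      + n ℤ.- (+ S ℤ.+ + S)
        ≡⟨ cong (ℤ._- (+ S ℤ.+ + S)) order ⟩
      -- The factor 2 in `mooreBound` unfolds to a sum ending in `S + 0`.
      + 4 ℤ.+ + (S + (S + 0)) ℤ.- (+ S ℤ.+ + S)
        ≡⟨ cong (λ s → + 4 ℤ.+ + (S + s) ℤ.- (+ S ℤ.+ + S)) (ℕ.+-identityʳ S) ⟩
      + 4 ℤ.+ (+ S ℤ.+ + S) ℤ.- (+ S ℤ.+ + S)
        ≡⟨ add-sub (+ 4) (+ S) (+ S) ⟨
      + 4 ∎
      where
      S : ℕ
      S = geometricSum (k ∸ 1) (suc m)
      add-sub : ∀ x a b → x ≡ x ℤ.+ (a ℤ.+ b) ℤ.- (a ℤ.+ b)
      add-sub = ℤ-Solver.solve-∀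
      restore : ∀ a b → 1ℤ ℤ.- (a ℤ.+ b) ℤ.+ (a ℤ.+ b) ≡ 1ℤ
      restore = ℤ-Solver.solve-∀
      total : sum (ξ u v) ℤ.+ (sum (h m u) ℤ.+ sum (h m v)) ≡ + n
      total = begin
        sum (ξ u v) ℤ.+ (sum (h m u) ℤ.+ sum (h m v))
          ≡⟨ cong (λ s → sum (ξ u v) ℤ.+ s) (∑-distrib-+ (h m u) (h m v)) ⟨
        sum (ξ u v) ℤ.+ sum (λ x → h m u x ℤ.+ h m v x)
          ≡⟨ ∑-distrib-+ (ξ u v) (λ x → h m u x ℤ.+ h m v x) ⟨
        sum (λ x → ξ u v x ℤ.+ (h m u x ℤ.+ h m v x))
          ≡⟨ sum-cong-≗ (λ x → restore (h m u x) (h m v x)) ⟩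
        sum {n} (λ _ → 1ℤ)
          ≡⟨ trans (sum-const n 1ℤ) (ℤ.*-identityʳ (+ n)) ⟩
        + n ∎

    ∑∼-ξ : ∀ u v y → ∑∼ y (h m u) ℤ.+ ∑∼ y (h m v) ℤ.+ ∑∼ y (ξ u v) ≡ + k
    ∑∼-ξ u v y = begin
      ∑∼ y (h m u) ℤ.+ ∑∼ y (h m v) ℤ.+ ∑∼ y (ξ u v)
        ≡⟨ cong (ℤ._+ ∑∼ y (ξ u v)) (∑∼-+ y (h m u) (h m v)) ⟨
      ∑∼ y (λ x → h m u x ℤ.+ h m v x) ℤ.+ ∑∼ y (ξ u v)
        ≡⟨ ∑∼-+ y (λ x → h m u x ℤ.+ h m v x) (ξ u v) ⟨
      ∑∼ y (λ x → h m u x ℤ.+ h m v x ℤ.+ ξ u v x)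
        ≡⟨ ∑∼-cong y (λ {x} _ → cancel (h m u x) (h m v x)) ⟩
      ∑∼ y (λ _ → 1ℤ)
        ≡⟨ ∑∼-1 y ⟩
      + k ∎
      where
      cancel : ∀ a b → a ℤ.+ b ℤ.+ (1ℤ ℤ.- (a ℤ.+ b)) ≡ 1ℤ
      cancel = ℤ-Solver.solve-∀

    -- H₂(A) + H₁(A) = A² − (k−1)I + A has entries at most 1, as there are no triangles.
    two-steps : ∀ x z → ∑∼ x (λ y → A y z) ℤ.+ A x z ℤ.≤ 1ℤ ℤ.+ c ℤ.* identity x z
    two-steps x z = ≤-transfer H₂+H₁≤1 $ begin
      h 2 x z ℤ.+ h 1 x z ℤ.+ (1ℤ ℤ.+ c ℤ.* identity x z)
        ≡⟨ cong₂ (λ s t → s ℤ.+ t ℤ.+ (1ℤ ℤ.+ c ℤ.* identity x z)) H₂≡ (H₁ x z) ⟩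
      ∑∼ x (λ y → A y z) ℤ.+ ℤ.- c ℤ.* identity x z ℤ.+ A x z ℤ.+ (1ℤ ℤ.+ c ℤ.* identity x z)
        ≡⟨ cancel (∑∼ x (λ y → A y z)) c (identity x z) (A x z) ⟩
      1ℤ ℤ.+ (∑∼ x (λ y → A y z) ℤ.+ A x z) ∎
      where
      cancel : ∀ s c i a → s ℤ.+ ℤ.- c ℤ.* i ℤ.+ a ℤ.+ (1ℤ ℤ.+ c ℤ.* i) ≡ 1ℤ ℤ.+ (s ℤ.+ a)
      cancel = ℤ-Solver.solve-∀
      H₂≡ : h 2 x z ≡ ∑∼ x (λ y → A y z) ℤ.+ ℤ.- c ℤ.* identity x z
      H₂≡ = trans (H₂₊ 0 x z)
        (cong₂ (λ s t → s ℤ.+ ℤ.- c ℤ.* t) (∑∼-cong x (λ {y} _ → H₁ y z)) (H₀ x z))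
      bound : (p? : Dec (Walk G 2 x z)) (q? : Dec (Walk G 1 x z)) → ⟦ p? ⟧ ℤ.+ ⟦ q? ⟧ ℤ.≤ 1ℤ
      bound (yes p) (yes (e ∷ [])) = contradiction (snoc G p (∼-sym e))
        (no-odd-closed-walk G (suc m) girth≥ 1 (ℕ.≤-trans m≥2 (ℕ.n≤1+n m)))
      bound (yes _) (no _)  = ℤ.≤-refl
      bound (no _)  (yes _) = ℤ.≤-refl
      bound (no _)  (no _)  = ℤ.+≤+ z≤n
      H₂+H₁≤1 : h 2 x z ℤ.+ h 1 x z ℤ.≤ 1ℤ
      H₂+H₁≤1 = subst (ℤ._≤ 1ℤ)
        -- Index 2 lies below half the girth because `m ≥ 2`. That `h 2` has only entries 0 and 1
        -- expresses the absence of 4-cycles.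
        (sym (cong₂ ℤ._+_ (H-walk (suc m) girth≥ k≥1 2 (s≤s m≥2) x z)
                          (H-walk (suc m) girth≥ k≥1 1 (ℕ.≤-trans m≥2 (ℕ.n≤1+n m)) x z)))
        (bound (walk? G 2 x z) (walk? G 1 x z))

    -- Weighting `two-steps` by the indicator of X and summing over `z` counts each of the four
    -- vertices at most once, except that `x` itself may count `1 + c = k` times.
    ξ-two-steps : ∀ {u v} → u ∼ v → ∀ x →
      ∑∼ x (λ y → ∑∼ y (ξ u v)) ℤ.+ ∑∼ x (ξ u v) ℤ.≤ + 4 ℤ.+ c ℤ.* ξ u v x
    ξ-two-steps {u} {v} e x = subst₂ ℤ._≤_ left right (sum-mono pointwise)
      where
      X : Fin n → ℤ
      X = ξ u v
      pointwise : ∀ z → (∑∼ x (λ y → A y z) ℤ.+ A x z) ℤ.* X z ℤ.≤ (1ℤ ℤ.+ c ℤ.* identity x z) ℤ.* X z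
      pointwise z = ℤ.*-monoʳ-≤-nonNeg (X z) {{ℤ.nonNegative (ξ-nonNeg e z)}} (two-steps x z)
      expand : ∀ z → (∑∼ x (λ y → A y z) ℤ.+ A x z) ℤ.* X z ≡ ∑∼ x (λ y → A y z ℤ.* X z) ℤ.+ A x z ℤ.* X z
      expand z = begin
        (∑∼ x (λ y → A y z) ℤ.+ A x z) ℤ.* X z
          ≡⟨ distribute (∑∼ x (λ y → A y z)) (A x z) (X z) ⟩
        X z ℤ.* ∑∼ x (λ y → A y z) ℤ.+ A x z ℤ.* X z
          ≡⟨ cong (ℤ._+ A x z ℤ.* X z) (∑∼-*ˡ x (X z) (λ y → A y z)) ⟨
        ∑∼ x (λ y → X z ℤ.* A y z) ℤ.+ A x z ℤ.* X z
          ≡⟨ cong (ℤ._+ A x z ℤ.* X z) (∑∼-cong x (λ {y} _ → ℤ.*-comm (X z) (A y z))) ⟩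
        ∑∼ x (λ y → A y z ℤ.* X z) ℤ.+ A x z ℤ.* X z ∎
        where
        distribute : ∀ s a t → (s ℤ.+ a) ℤ.* t ≡ t ℤ.* s ℤ.+ a ℤ.* t
        distribute = ℤ-Solver.solve-∀
      left : sum (λ z → (∑∼ x (λ y → A y z) ℤ.+ A x z) ℤ.* X z) ≡ ∑∼ x (λ y → ∑∼ y X) ℤ.+ ∑∼ x X
      left = begin
        sum (λ z → (∑∼ x (λ y → A y z) ℤ.+ A x z) ℤ.* X z)
          ≡⟨ sum-cong-≗ expand ⟩
        sum (λ z → ∑∼ x (λ y → A y z ℤ.* X z) ℤ.+ A x z ℤ.* X z)
          ≡⟨ ∑-distrib-+ (λ z → ∑∼ x (λ y → A y z ℤ.* X z)) (λ z → A x z ℤ.* X z) ⟩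
        sum (λ z → ∑∼ x (λ y → A y z ℤ.* X z)) ℤ.+ ∑∼ x X
          ≡⟨ cong (ℤ._+ ∑∼ x X) (∑∼-sum x (λ y z → A y z ℤ.* X z)) ⟨
        ∑∼ x (λ y → ∑∼ y X) ℤ.+ ∑∼ x X ∎
      distribute′ : ∀ c i t → (1ℤ ℤ.+ c ℤ.* i) ℤ.* t ≡ t ℤ.+ c ℤ.* (i ℤ.* t)
      distribute′ = ℤ-Solver.solve-∀
      right : sum (λ z → (1ℤ ℤ.+ c ℤ.* identity x z) ℤ.* X z) ≡ + 4 ℤ.+ c ℤ.* X x
      right = begin
        sum (λ z → (1ℤ ℤ.+ c ℤ.* identity x z) ℤ.* X z)
          ≡⟨ sum-cong-≗ (λ z → distribute′ c (identity x z) (X z)) ⟩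
        sum (λ z → X z ℤ.+ c ℤ.* (identity x z ℤ.* X z))
          ≡⟨ ∑-distrib-+ X (λ z → c ℤ.* (identity x z ℤ.* X z)) ⟩
        sum X ℤ.+ sum (λ z → c ℤ.* (identity x z ℤ.* X z))
          ≡⟨ cong₂ ℤ._+_ (sum-ξ u v) (sym (*-distribˡ-sum c (λ z → identity x z ℤ.* X z))) ⟩
        + 4 ℤ.+ c ℤ.* sum (λ z → identity x z ℤ.* X z)
          ≡⟨ cong (λ s → + 4 ℤ.+ c ℤ.* s) (sum-identityˡ x X) ⟩
        + 4 ℤ.+ c ℤ.* X x ∎

    -- Commuting `A` past `h m` turns both sums into sums over the `k` neighbours `w` of `v`. The
    -- row at `w` cannot contain both ends of the edge `xy`.
    ∑∼-h-edge≤k : ∀ {x y} → x ∼ y → ∀ v → ∑∼ x (h m v) ℤ.+ ∑∼ y (h m v) ℤ.≤ + k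
    ∑∼-h-edge≤k {x} {y} e v = subst₂ ℤ._≤_ left (∑∼-1 v) (∑∼-mono v (λ {w} _ → h-edge≤1′ e w))
      where
      left : ∑∼ v (λ w → h m w x ℤ.+ h m w y) ≡ ∑∼ x (h m v) ℤ.+ ∑∼ y (h m v)
      left = trans (∑∼-+ v (λ w → h m w x) (λ w → h m w y))
                   (sym (cong₂ ℤ._+_ (H-commutes m v x) (H-commutes m v y)))

    -- No neighbour of `y` lies in row `u`, so the `k` neighbours of `y` are split between row `v`
    -- and X. By `∑∼-h-edge≤k`, those in row `v` leave room for at least as many in X as `x` has
    -- neighbours in row `v`.
    leaf-degree : ∀ {u v x y} → Walk G m u y → x ∼ y → ∑∼ x (h m v) ℤ.≤ ∑∼ y (ξ u v)
    leaf-degree {u} {v} {x} {y} p e = ≤-transfer (∑∼-h-edge≤k e v) $ begin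
      ∑∼ x (h m v) ℤ.+ ∑∼ y (h m v) ℤ.+ ∑∼ y (ξ u v)
        ≡⟨ rearrange (∑∼ x (h m v)) (∑∼ y (h m v)) (∑∼ y (ξ u v)) ⟩
      0ℤ ℤ.+ ∑∼ y (h m v) ℤ.+ ∑∼ y (ξ u v) ℤ.+ ∑∼ x (h m v)
        ≡⟨ cong (λ s → s ℤ.+ ∑∼ y (h m v) ℤ.+ ∑∼ y (ξ u v) ℤ.+ ∑∼ x (h m v)) ∑∼h≡0 ⟨
      ∑∼ y (h m u) ℤ.+ ∑∼ y (h m v) ℤ.+ ∑∼ y (ξ u v) ℤ.+ ∑∼ x (h m v)
        ≡⟨ cong (ℤ._+ ∑∼ x (h m v)) (∑∼-ξ u v y) ⟩
      + k ℤ.+ ∑∼ x (h m v) ∎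
      where
      rearrange : ∀ a b r → a ℤ.+ b ℤ.+ r ≡ 0ℤ ℤ.+ b ℤ.+ r ℤ.+ a
      rearrange = ℤ-Solver.solve-∀
      ∑∼h≡0 : ∑∼ y (h m u) ≡ 0ℤ
      ∑∼h≡0 = ∑∼-zero λ e′ → h-false λ q →
        walks-from-edge G (suc m) girth≥ ℕ.≤-refl e′ (reverse G p) (reverse G q)

    -- Counts walks from `x` over a neighbour `y` into X: by `leaf-degree`, each `y` in row `u`
    -- yields at least `q` and each in row `v` at least `p`, while each in X yields at least 1. The
    -- function `share` joins these three bounds; the second `r` counts the vertices of X one step
    -- away.
    far-neighbours : ∀ {u v x} → u ∼ v → ¬ Walk G m u x → ¬ Walk G m v x →
      let p = ∑∼ x (h m u) ; q = ∑∼ x (h m v) ; r = ∑∼ x (ξ u v) in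
      q ℤ.* p ℤ.+ p ℤ.* q ℤ.+ (r ℤ.+ r) ℤ.≤ + 4 ℤ.+ c
    far-neighbours {u} {v} {x} e ¬ux ¬vx = subst₂ ℤ._≤_ left right $
      ℤ.≤-trans (ℤ.+-monoˡ-≤ r (∑∼-mono x contribution)) (ξ-two-steps e x)
      where
      p q r : ℤ
      p = ∑∼ x (h m u)
      q = ∑∼ x (h m v)
      r = ∑∼ x (ξ u v)
      ξ≡ : ∀ {y a b} → h m u y ≡ a → h m v y ≡ b → ξ u v y ≡ 1ℤ ℤ.- (a ℤ.+ b)
      ξ≡ = cong₂ (λ a b → 1ℤ ℤ.- (a ℤ.+ b))
      share : Fin n → ℤ
      share y = q ℤ.* h m u y ℤ.+ p ℤ.* h m v y ℤ.+ ξ u v y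
      share≡ : ∀ {y a b} → h m u y ≡ a → h m v y ≡ b →
               share y ≡ q ℤ.* a ℤ.+ p ℤ.* b ℤ.+ (1ℤ ℤ.- (a ℤ.+ b))
      share≡ = cong₂ (λ a b → q ℤ.* a ℤ.+ p ℤ.* b ℤ.+ (1ℤ ℤ.- (a ℤ.+ b)))
      leafᵘ : ∀ p q → q ≡ q ℤ.* 1ℤ ℤ.+ p ℤ.* 0ℤ ℤ.+ 0ℤ
      leafᵘ = ℤ-Solver.solve-∀
      leafᵛ : ∀ p q → p ≡ q ℤ.* 0ℤ ℤ.+ p ℤ.* 1ℤ ℤ.+ 0ℤ
      leafᵛ = ℤ-Solver.solve-∀
      outside : ∀ p q → 1ℤ ≡ q ℤ.* 0ℤ ℤ.+ p ℤ.* 0ℤ ℤ.+ 1ℤ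
      outside = ℤ-Solver.solve-∀
      contribution : ∀ {y} → x ∼ y → share y ℤ.≤ ∑∼ y (ξ u v)
      contribution {y} f with walk? G m u y | walk? G m v y
      ... | yes uy | yes vy = contradiction vy (walks-from-edge G (suc m) girth≥ ℕ.≤-refl e uy)
      ... | yes uy | no ¬vy =
        subst (ℤ._≤ ∑∼ y (ξ u v)) (trans (leafᵘ p q) (sym (share≡ (h-true uy) (h-false ¬vy))))
              (leaf-degree uy f)
      ... | no ¬uy | yes vy =
        subst₂ ℤ._≤_ (trans (leafᵛ p q) (sym (share≡ (h-false ¬uy) (h-true vy))))
               (∑∼-cong y (λ {z} _ → ξ-swap v u z)) (leaf-degree vy f)
      ... | no ¬uy | no ¬vy =
        -- The vertex of X found next to `y` is `x` itself.
        subst (ℤ._≤ ∑∼ y (ξ u v))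
              (trans (ξ≡ (h-false ¬ux) (h-false ¬vx))
                     (trans (outside p q) (sym (share≡ (h-false ¬uy) (h-false ¬vy)))))
              (term≤∑∼ (ξ-nonNeg e) (∼-sym f))
      left : ∑∼ x share ℤ.+ r ≡ q ℤ.* p ℤ.+ p ℤ.* q ℤ.+ (r ℤ.+ r)
      left = begin
        ∑∼ x share ℤ.+ r
          ≡⟨ cong (ℤ._+ r) (∑∼-+ x (λ y → q ℤ.* h m u y ℤ.+ p ℤ.* h m v y) (ξ u v)) ⟩
        ∑∼ x (λ y → q ℤ.* h m u y ℤ.+ p ℤ.* h m v y) ℤ.+ r ℤ.+ r
          ≡⟨ cong (λ s → s ℤ.+ r ℤ.+ r) (∑∼-+ x (λ y → q ℤ.* h m u y) (λ y → p ℤ.* h m v y)) ⟩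
        ∑∼ x (λ y → q ℤ.* h m u y) ℤ.+ ∑∼ x (λ y → p ℤ.* h m v y) ℤ.+ r ℤ.+ r
          ≡⟨ cong₂ (λ s t → s ℤ.+ t ℤ.+ r ℤ.+ r) (∑∼-*ˡ x q (h m u)) (∑∼-*ˡ x p (h m v)) ⟩
        q ℤ.* p ℤ.+ p ℤ.* q ℤ.+ r ℤ.+ r
          ≡⟨ ℤ.+-assoc (q ℤ.* p ℤ.+ p ℤ.* q) r r ⟩
        q ℤ.* p ℤ.+ p ℤ.* q ℤ.+ (r ℤ.+ r) ∎
      right : + 4 ℤ.+ c ℤ.* ξ u v x ≡ + 4 ℤ.+ c
      right = cong (λ s → + 4 ℤ.+ s)
        (trans (cong (λ s → c ℤ.* s) (ξ≡ (h-false ¬ux) (h-false ¬vx))) (ℤ.*-identityʳ c))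

    -- The last vertex before `x` lies in row `u`. Together with `∑∼h≡0` this translates between
    -- walks of length `suc m` and positivity of p or q.
    one≤∑∼h : ∀ {u x} → Walk G (suc m) u x → 1ℤ ℤ.≤ ∑∼ x (h m u)
    one≤∑∼h {u} {x} p = case reverse G p of λ
      { (f ∷ q) → subst (ℤ._≤ ∑∼ x (h m u)) (h-true (reverse G q)) (term≤∑∼ (h-nonNeg u) f) }

    ∑∼h≡0 : ∀ {u x} → ¬ Walk G (suc m) u x → ∑∼ x (h m u) ≡ 0ℤ
    ∑∼h≡0 ¬p = ∑∼-zero λ f → h-false λ q → ¬p (snoc G q (∼-sym f))

    -- With `p = 1 + a`, `q = 1 + b` and `p + q + r = k`, the bound `2pq + 2r ≤ k + 3` becomes
    -- `2ab + k ≤ 5`, against `k ≥ 6`.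
    not-near-both : ∀ {u v x} → u ∼ v → ¬ Walk G m u x → ¬ Walk G m v x →
      Walk G (suc m) u x → ¬ Walk G (suc m) v x
    not-near-both {u} {v} {x} e ¬ux ¬vx ux vx =
      k≰5 (∑∼ x (h m u)) (∑∼ x (h m v)) (∑∼ x (ξ u v)) (∑∼-ξ u v x)
          (one≤∑∼h ux) (one≤∑∼h vx) (far-neighbours e ¬ux ¬vx)
      where
      certificate : ∀ a b r → let p = 1ℤ ℤ.+ a ; q = 1ℤ ℤ.+ b ; κ = p ℤ.+ q ℤ.+ r in
        q ℤ.* p ℤ.+ p ℤ.* q ℤ.+ (r ℤ.+ r) ℤ.+ + 5 ≡
        + 4 ℤ.+ (κ ℤ.- 1ℤ) ℤ.+ (a ℤ.* b ℤ.+ a ℤ.* b ℤ.+ κ)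
      certificate = ℤ-Solver.solve-∀
      k≰5 : ∀ p q r → p ℤ.+ q ℤ.+ r ≡ + k → 1ℤ ℤ.≤ p → 1ℤ ℤ.≤ q →
            ¬ q ℤ.* p ℤ.+ p ℤ.* q ℤ.+ (r ℤ.+ r) ℤ.≤ + 4 ℤ.+ (+ k ℤ.- 1ℤ)
      k≰5 (+ suc a) (+ suc b) r p+q+r≡k (ℤ.+≤+ (s≤s _)) (ℤ.+≤+ (s≤s _)) bound =
        ℕ.<⇒≱ k≥6 (ℕ.m+n≤o⇒n≤o (a * b + a * b) (ℤ.drop‿+≤+ 2ab+k≤5))
        where
        2ab+k≤5 : + (a * b + a * b + k) ℤ.≤ + 5
        2ab+k≤5 = ≤-transfer bound $ subst
          (λ κ → + suc b ℤ.* + suc a ℤ.+ + suc a ℤ.* + suc b ℤ.+ (r ℤ.+ r) ℤ.+ + 5 ≡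
                 + 4 ℤ.+ (κ ℤ.- 1ℤ) ℤ.+ (+ (a * b) ℤ.+ + (a * b) ℤ.+ κ))
          p+q+r≡k
          (subst (λ s → + suc b ℤ.* + suc a ℤ.+ + suc a ℤ.* + suc b ℤ.+ (r ℤ.+ r) ℤ.+ + 5 ≡
                        + 4 ℤ.+ (+ suc a ℤ.+ + suc b ℤ.+ r ℤ.- 1ℤ) ℤ.+ (s ℤ.+ s ℤ.+ (+ suc a ℤ.+ + suc b ℤ.+ r)))
                 (sym (ℤ.pos-* a b)) (certificate (+ a) (+ b) r))

    -- If both p and q vanished, then `r = k` and `2k ≤ k + 3`, hence `k ≤ 3`.
    near-one : ∀ {u v x} → u ∼ v → ¬ Walk G m u x → ¬ Walk G m v x →
      ¬ Walk G (suc m) u x → Walk G (suc m) v x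
    near-one {u} {v} {x} e ¬ux ¬vx ¬ux′ with walk? G (suc m) v x
    ... | yes vx′ = vx′
    ... | no ¬vx′ = contradiction (ℤ.drop‿+≤+ k≤3) (ℕ.<⇒≱ (ℕ.≤-trans (ℕ.m≤m+n 4 2) k≥6))
      where
      r : ℤ
      r = ∑∼ x (ξ u v)
      r≡k : r ≡ + k
      r≡k = trans (sym (ℤ.+-identityˡ r))
        (subst₂ (λ p q → p ℤ.+ q ℤ.+ r ≡ + k) (∑∼h≡0 ¬ux′) (∑∼h≡0 ¬vx′) (∑∼-ξ u v x))
      2k≤k+3 : + k ℤ.+ + k ℤ.≤ + 4 ℤ.+ c
      2k≤k+3 = subst (ℤ._≤ + 4 ℤ.+ c) (trans (ℤ.+-identityˡ (r ℤ.+ r)) (cong₂ ℤ._+_ r≡k r≡k))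
        (subst₂ (λ p q → q ℤ.* p ℤ.+ p ℤ.* q ℤ.+ (r ℤ.+ r) ℤ.≤ + 4 ℤ.+ c)
                (∑∼h≡0 ¬ux′) (∑∼h≡0 ¬vx′) (far-neighbours e ¬ux ¬vx))
      certificate : ∀ κ → κ ℤ.+ κ ℤ.+ + 3 ≡ + 4 ℤ.+ (κ ℤ.- 1ℤ) ℤ.+ κ
      certificate = ℤ-Solver.solve-∀
      k≤3 : + k ℤ.≤ + 3
      k≤3 = ≤-transfer 2k≤k+3 (certificate (+ k))

    -- The excess matrix and the identity on edges.

    private
      E B : Matrix n
      E = excessMatrix G (suc m)
      B = h m +ᴹ E

    E-false : ∀ {u x l} → l < suc (suc m) → Walk G l u x → E u x ≡ 0ℤ
    E-false {u} {x} l< p = ⟦⟧-false (distance? G u x (suc (suc m))) λ (_ , minimal) → minimal l< p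

    -- The walk through `u` has length `d + 1`. A walk of length at most `m` could be padded to
    -- length `m` or `suc m`, and both are excluded.
    E-true : ∀ {u v x} → u ∼ v → ¬ Walk G m v x → ¬ Walk G (suc m) v x → Walk G (suc m) u x → E v x ≡ 1ℤ
    E-true {u} {v} {x} e ¬vx ¬vx′ ux = ⟦⟧-true (distance? G v x (suc (suc m))) (∼-sym e ∷ ux , minimal)
      where
      minimal : ∀ {l} → l < suc (suc m) → ¬ Walk G l v x
      minimal (s≤s l≤m+1) p with ℕ.m≤n⇒m<n∨m≡n l≤m+1
      ... | inj₂ refl = ¬vx′ p
      ... | inj₁ (s≤s l≤m) with pad G (neighbour k≥1) l≤m p
      ...   | inj₁ q = ¬vx q
      ...   | inj₂ q = ¬vx′ q

    B-at-walk : ∀ {u v x} → u ∼ v → Walk G m u x → B u x ℤ.+ B v x ≡ 1ℤ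
    B-at-walk {u} {v} {x} e p = cong₂ ℤ._+_
      (cong₂ ℤ._+_ (h-true p) (E-false (ℕ.m≤n⇒m≤1+n ℕ.≤-refl) p))
      (cong₂ ℤ._+_ (h-false (walks-from-edge G (suc m) girth≥ ℕ.≤-refl e p))
                   (E-false ℕ.≤-refl (∼-sym e ∷ p)))

    -- Of the four entries involved only `E v x` survives, by `not-near-both`.
    B-far : ∀ {u v x} → u ∼ v → ¬ Walk G m u x → ¬ Walk G m v x →
            Walk G (suc m) u x → B u x ℤ.+ B v x ≡ 1ℤ
    B-far e ¬ux ¬vx ux = cong₂ ℤ._+_
      (cong₂ ℤ._+_ (h-false ¬ux) (E-false ℕ.≤-refl ux))
      (cong₂ ℤ._+_ (h-false ¬vx) (E-true e ¬vx (not-near-both e ¬ux ¬vx ux) ux))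

    -- Either one of the two rows of `h m` contains `x`, or `x` is in X and `near-one` shows which
    -- end is the nearer.
    B-edge : ∀ {u v} → u ∼ v → ∀ x → B u x ℤ.+ B v x ≡ 1ℤ
    B-edge {u} {v} e x = cases (walk? G m u x) (walk? G m v x) (walk? G (suc m) u x)
      where
      cases : Dec (Walk G m u x) → Dec (Walk G m v x) → Dec (Walk G (suc m) u x) → B u x ℤ.+ B v x ≡ 1ℤ
      cases (yes p) _       _        = B-at-walk e p
      cases (no _)  (yes q) _        = trans (ℤ.+-comm (B u x) (B v x)) (B-at-walk (∼-sym e) q)
      cases (no ¬p) (no ¬q) (yes p′) = B-far e ¬p ¬q p′
      cases (no ¬p) (no ¬q) (no ¬p′) =
        trans (ℤ.+-comm (B u x) (B v x)) (B-far (∼-sym e) ¬q ¬p (near-one e ¬p ¬q ¬p′))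

    kJ≈[A+kI]B : (+ k) ·ᴹ allOnes ≈ᴹ (A +ᴹ (+ k) ·ᴹ identity) *ᴹ B
    kJ≈[A+kI]B u v = sym $ begin
      sum (λ w → (A u w ℤ.+ + k ℤ.* identity u w) ℤ.* B w v)
        ≡⟨ sum-cong-≗ (λ w → distribute (A u w) (+ k) (identity u w) (B w v)) ⟩
      sum (λ w → A u w ℤ.* B w v ℤ.+ + k ℤ.* (identity u w ℤ.* B w v))
        ≡⟨ ∑-distrib-+ (λ w → A u w ℤ.* B w v) (λ w → + k ℤ.* (identity u w ℤ.* B w v)) ⟩
      ∑∼ u (λ w → B w v) ℤ.+ sum (λ w → + k ℤ.* (identity u w ℤ.* B w v))
        ≡⟨ cong (λ s → ∑∼ u (λ w → B w v) ℤ.+ s) (*-distribˡ-sum (+ k) (λ w → identity u w ℤ.* B w v)) ⟨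
      ∑∼ u (λ w → B w v) ℤ.+ + k ℤ.* sum (λ w → identity u w ℤ.* B w v)
        ≡⟨ cong (λ s → ∑∼ u (λ w → B w v) ℤ.+ + k ℤ.* s) (sum-identityˡ u (λ w → B w v)) ⟩
      ∑∼ u (λ w → B w v) ℤ.+ + k ℤ.* B u v
        -- The diagonal term is spread over the `k` neighbours of `u`, one copy each, so that every
        -- edge at `u` brings together the two rows of `B-edge`.
        ≡⟨ cong (λ s → ∑∼ u (λ w → B w v) ℤ.+ s) (trans (∑∼-const u (B u v)) (ℤ.*-comm (B u v) (+ k))) ⟨
      ∑∼ u (λ w → B w v) ℤ.+ ∑∼ u (λ _ → B u v)
        ≡⟨ ∑∼-+ u (λ w → B w v) (λ _ → B u v) ⟨
      ∑∼ u (λ w → B w v ℤ.+ B u v)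
        ≡⟨ ∑∼-cong u (λ e → B-edge (∼-sym e) v) ⟩
      ∑∼ u (λ _ → 1ℤ)
        ≡⟨ trans (∑∼-1 u) (sym (ℤ.*-identityʳ (+ k))) ⟩
      + k ℤ.* 1ℤ ∎
      where
      distribute : ∀ a k i b → (a ℤ.+ k ℤ.* i) ℤ.* b ≡ a ℤ.* b ℤ.+ k ℤ.* (i ℤ.* b)
      distribute = ℤ-Solver.solve-∀

lemma2p3 : ∀ (k d n : ℕ) (G : Graph n) →
    k ≥ 6 → 2 * d ≥ 6 →
    IsKGGraph k (2 * d) G →
    excess G k d ≡ + 4 →
    (+ k) ·ᴹ allOnes ≈ᴹ (adjacency G +ᴹ (+ k) ·ᴹ identity) *ᴹ (evalᴹ (H k (d ∸ 1)) (adjacency G) +ᴹ excessMatrix G d)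
lemma2p3 k zero n G _ () _ _
lemma2p3 k (suc m) n G k≥6 g≥6 kg excess≡4 =
  kJ≈[A+kI]B G k (IsKGGraph.regular kg) m
    -- With `d = suc m`, halving `6 ≤ 2 * d` gives `3 ≤ suc m`, that is `m ≥ 2`.
    (ℕ.≤-pred (ℕ.*-cancelˡ-≤ {3} {suc m} 2 g≥6))
    (λ {l} C → subst (_≤ l) (cong (λ s → suc m + s) (ℕ.+-identityʳ (suc m))) (proj₂ (IsKGGraph.girth kg) C))
    k≥6
    (trans (sub-add (+ n) (+ mooreBound k (suc m))) (cong (ℤ._+ + mooreBound k (suc m)) excess≡4))
  where
  sub-add : ∀ a b → a ≡ a ℤ.- b ℤ.+ b
  sub-add = ℤ-Solver.solve-∀
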